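{- Among all bicyclic configurations $P$, $$\min_P\bigl(e(P)+s(P)\bigr)=11 .$$ Up to relabeling colors and interchanging rows with columns, equality occurs in exactly two ways: (1) $P=R\times K$ (so $P\cong K_{2,3}$), where $|R|=2$, $|K|=3$ and $R\cap K=\varnothing$; (2) $R=\{a,b,x\}$ and $K=\{a,b,y\}$, where $a\ne b$, $x\neq y$ and $x,y\notin\{a,b\}$, and $P=(R\times K)\setminus\{(a,a),(b,b)\}$.
   Context: A two-spine configuration is a finite set $P$ of ordered pairs $(x,y)$ of distinct colors (colors drawn from any finite set). It is viewed as a bipartite graph: $(x,y)\in P$ is an edge from the row copy of $x$ to the column copy of $y$; row $c$ and column $c$ are distinct vertices. Let $R(P)$ be the set of colors occurring as first coordinates (row colors) and $K(P)$ the set occurring as second coordinates (column colors) of pairs in $P$; the vertex set of the graph is the disjoint union of row copies of $R(P)$ and column copies of $K(P)$. Put $e(P)=|P|$, $v(P)=|R(P)|+|K(P)|$, and $s(P)=|R(P)\cup K(P)|$. A bicyclic configuration is a two-spine configuration $P$ that is connected as a graph and satisfies $e(P)=v(P)+1$. In the claim, $R=R(P)$ and $K=K(P)$. Interchanging rows with columns means replacing $P$ by $\{(y,x):(x,y)\in P\}$. -}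

module Defs where

open import Data.Nat.Base using (ℕ; _+_)
open import Data.Fin.Base using (Fin)
open import Data.Fin.Subset using (Subset; ⊥; ⁅_⁆; _∪_; _∩_; ⋃; ∣_∣; _∈_; _∉_)
open import Data.List.Base using (List; map; length)
open import Data.List.Membership.Propositional using () renaming (_∈_ to _∈ˡ_)
open import Data.List.Relation.Unary.All as All using (All)
import Data.List.Relation.Unary.All.Properties as All
open import Data.List.Relation.Unary.Unique.Propositional using (Unique)
import Data.List.Relation.Unary.Unique.Propositional.Properties as Unique
open import Data.Product using (_×_; _,_; proj₁; proj₂; swap; ∃; ∃₂; ∃-syntax)
open import Data.Sum.Base using (_⊎_; inj₁; inj₂)
open import Function.Base using (_∘_)
open import Function.Bundles using (_⇔_)
open import Function.Definitions using (Injective)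
open import Relation.Binary.Construct.Closure.Equivalence using (EqClosure)
open import Relation.Binary.Construct.Closure.Symmetric using (SymClosure)
open import Relation.Binary.PropositionalEquality using (_≡_; _≢_; sym; cong)

-- A finite set of pairs is a duplicate-free list; nothing below depends on
-- the order of the list.  The ambient finite set of colors is Fin n, and not
-- every color of Fin n has to be used.
record Configuration (n : ℕ) : Set where
  field
    pairs    : List (Fin n × Fin n)
    unique   : Unique pairs
    distinct : All (λ (x , y) → x ≢ y) pairs

open Configuration public

infix 4 _∈ᶜ_

_∈ᶜ_ : ∀ {n} → Fin n × Fin n → Configuration n → Set
p ∈ᶜ P = p ∈ˡ pairs P

R : ∀ {n} → Configuration n → Subset n
R P = ⋃ (map (⁅_⁆ ∘ proj₁) (pairs P))

K : ∀ {n} → Configuration n → Subset n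
K P = ⋃ (map (⁅_⁆ ∘ proj₂) (pairs P))

e : ∀ {n} → Configuration n → ℕ
e P = length (pairs P)

v : ∀ {n} → Configuration n → ℕ
v P = ∣ R P ∣ + ∣ K P ∣

s : ∀ {n} → Configuration n → ℕ
s P = ∣ R P ∪ K P ∣

-- inj₁ c is the row copy of c and inj₂ c its column copy.  The vertices of
-- the graph of P are only those singled out by IsVertex P.
Vertex : ℕ → Set
Vertex n = Fin n ⊎ Fin n

IsVertex : ∀ {n} → Configuration n → Vertex n → Set
IsVertex P (inj₁ x) = x ∈ R P
IsVertex P (inj₂ y) = y ∈ K P

data Edge {n} (P : Configuration n) : Vertex n → Vertex n → Set where
  edge : ∀ {x y} → (x , y) ∈ᶜ P → Edge P (inj₁ x) (inj₂ y)

-- The empty configuration is connected in this sense, but it is not bicyclic.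
Connected : ∀ {n} → Configuration n → Set
Connected P = ∀ u w → IsVertex P u → IsVertex P w → EqClosure (Edge P) u w

Bicyclic : ∀ {n} → Configuration n → Set
Bicyclic P = Connected P × e P ≡ v P + 1

interchange : ∀ {n} → Configuration n → Configuration n
interchange P = record
  { pairs    = map swap (pairs P)
  ; unique   = Unique.map⁺ (cong swap) (unique P)
  ; distinct = All.map⁺ (All.map (_∘ sym) (distinct P))
  }

-- The map f is defined on all ambient colors, but only its values on the
-- colors used by P matter; the ambient sets may have different sizes.
Relabels : ∀ {m n} → (Fin m → Fin n) → Configuration m → Configuration n → Set
Relabels f P Q =
  (∀ {c d} → c ∈ R P ∪ K P → d ∈ R P ∪ K P → f c ≡ f d → c ≡ d) ×
  (∀ u w → (u , w) ∈ᶜ Q ⇔ (∃₂ λ x y → (x , y) ∈ᶜ P × f x ≡ u × f y ≡ w))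

infix 4 _∼_

_∼_ : ∀ {m n} → Configuration m → Configuration n → Set
P ∼ Q = (∃[ f ] Relabels f P Q) ⊎ (∃[ f ] Relabels f (interchange P) Q)

data CompleteEdge (r k : ℕ) : Fin r ⊎ Fin k → Fin r ⊎ Fin k → Set where
  edge : ∀ i j → CompleteEdge r k (inj₁ i) (inj₂ j)

-- Isomorphism of undirected graphs between K_{r,k} and the graph of P.
IsCompleteBipartite : ∀ {n} → ℕ → ℕ → Configuration n → Set
IsCompleteBipartite {n} r k P =
  ∃ λ (φ : Fin r ⊎ Fin k → Vertex n) →
    Injective _≡_ _≡_ φ ×
    (∀ w → IsVertex P w ⇔ (∃[ i ] φ i ≡ w)) ×
    (∀ i j → SymClosure (CompleteEdge r k) i j ⇔ SymClosure (Edge P) (φ i) (φ j))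

CompleteForm : ∀ {n} → Configuration n → Set
CompleteForm P =
  ∣ R P ∣ ≡ 2 × ∣ K P ∣ ≡ 3 × R P ∩ K P ≡ ⊥ ×
  (∀ u w → (u , w) ∈ᶜ P ⇔ (u ∈ R P × w ∈ K P))

DeletedForm : ∀ {n} → Configuration n → Set
DeletedForm {n} P =
  ∃[ a ] ∃[ b ] ∃[ x ] ∃[ y ]
    a ≢ b × x ≢ y × x ∉ ⁅ a ⁆ ∪ ⁅ b ⁆ × y ∉ ⁅ a ⁆ ∪ ⁅ b ⁆ ×
    R P ≡ ⁅ a ⁆ ∪ ⁅ b ⁆ ∪ ⁅ x ⁆ × K P ≡ ⁅ a ⁆ ∪ ⁅ b ⁆ ∪ ⁅ y ⁆ ×
    (∀ u w → (u , w) ∈ᶜ P ⇔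
      (u ∈ R P × w ∈ K P × (u , w) ≢ (a , a) × (u , w) ≢ (b , b)))

{-# OPTIONS --safe #-}
module Submission where

-- Put r = |R|, k = |K| and t = |R ∩ K|.  The t diagonal pairs of R × K are not in P,
-- so e + t ≤ r k, with equality exactly when P is saturated, i.e. contains all pairs
-- of R × K off the diagonal.  For a bicyclic P this reads r + k + 1 + t ≤ r k, while
-- e + s = 2 (r + k) + 1 - t.  Hence e + s ≤ 11 bounds r and k by 5, leaving only
-- (r, k, t) = (2, 3, 0), (3, 2, 0), (3, 3, 2); these all have e + s = 11 and make the
-- first inequality an equality.  A saturated configuration is determined up to
-- relabeling by (r, k, t), and it is connected when t < r, k: a row outside K is then
-- adjacent to all columns, and a column outside R to all rows.

open import Defs
open import Data.Nat.Base using (ℕ; zero; suc; _+_; _*_; _≤_; _<_; z≤n; s≤s)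
open import Data.Nat.Properties as ℕ using (allUpTo?)
open import Data.Fin.Base as Fin using (Fin; zero; suc)
open import Data.Fin using (#_)
import Data.Fin.Properties as Fin
open import Data.Fin.Subset
  using (Subset; inside; outside; ⁅_⁆; _∪_; _∩_; _─_; ⋃; ∣_∣; _∈_; _∉_; Empty)
open import Data.Fin.Subset.Properties
open import Data.Vec.Base using ([]; _∷_; here; there)
open import Data.List.Base as List
  using (List; []; _∷_; _++_; map; length; lookup; cartesianProduct)
open import Data.List.Properties
  using (length-map; length-++; map-∘; map-cong-local; ∷-injective)
open import Data.List.Membership.Propositional using () renaming (_∈_ to _∈ˡ_)
open import Data.List.Membership.Propositional.Properties
  using (∈-map⁺; ∈-map⁻; ∈-++⁺ˡ; ∈-++⁺ʳ; ∈-++⁻; ∈-lookup; ∈-length;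
         ∈-cartesianProduct⁺; ∈-cartesianProduct⁻)
import Data.List.Membership.DecPropositional as DecMembership
open import Data.List.Relation.Unary.All as All using (All; []; _∷_; all?)
import Data.List.Relation.Unary.All.Properties as All
open import Data.List.Relation.Unary.AllPairs using ([]; _∷_)
open import Data.List.Relation.Unary.Any as Any using (here; there; index)
import Data.List.Relation.Unary.Any.Properties as Any
open import Data.List.Relation.Unary.Unique.Propositional using (Unique)
import Data.List.Relation.Unary.Unique.Propositional.Properties as Unique
import Data.List.Relation.Unary.Unique.DecPropositional as DecUnique
open import Data.List.Relation.Binary.Subset.Propositional using (_⊆_)
open import Data.Product using (_×_; _,_; proj₁; proj₂; swap; ∃₂; ∃-syntax)
open import Data.Product.Properties using (≡-dec; ,-injective)
open import Data.Sum.Base as Sum using (_⊎_; inj₁; inj₂; [_,_]′)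
open import Data.Sum.Properties using (inj₁-injective; inj₂-injective)
open import Function.Base using (_∘_; id; case_of_)
open import Function.Bundles using (_⇔_; mk⇔; Equivalence)
open import Function.Definitions using (Injective)
open import Relation.Binary.Construct.Closure.Equivalence as Eq using (EqClosure)
open import Relation.Binary.Construct.Closure.ReflexiveTransitive using (_◅◅_)
open import Relation.Binary.Construct.Closure.Symmetric using (SymClosure; fwd; bwd)
open import Relation.Binary.Definitions using (DecidableEquality)
open import Relation.Binary.PropositionalEquality
  using (_≡_; _≢_; refl; sym; trans; cong; cong₂; subst; subst₂)
open import Relation.Nullary using (¬_; yes; no; contradiction)
open import Relation.Nullary.Decidable using (from-yes; _→-dec_; ¬?; _×-dec_; _⊎-dec_)

open Equivalence using (to; from)

private variable
  A B : Set
  m n : ℕ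

-- Duplicate-free lists and finite functions

lookup-injective : {xs : List A} → Unique xs → Injective _≡_ _≡_ (lookup xs)
lookup-injective (_  ∷ _)  {zero}  {zero}  _  = refl
lookup-injective (x# ∷ _)  {zero}  {suc j} eq = contradiction eq (All.lookup x# (∈-lookup j))
lookup-injective (x# ∷ _)  {suc i} {zero}  eq = contradiction (sym eq) (All.lookup x# (∈-lookup i))
lookup-injective (_  ∷ xs!) {suc i} {suc j} eq = cong suc (lookup-injective xs! eq)

-- Pigeonhole: sending an index of `xs` to the place where its entry occurs in `ys` is injective,
-- because looking that place up gives the entry back.
length-mono-⊆ : {xs ys : List A} → Unique xs → xs ⊆ ys → length xs ≤ length ys
length-mono-⊆ {xs = xs} {ys} xs! xs⊆ys = Fin.injective⇒≤ {f = position} injective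
  where
  position : Fin (length xs) → Fin (length ys)
  position i = index (xs⊆ys (∈-lookup i))
  injective : Injective _≡_ _≡_ position
  injective {i} {j} eq = lookup-injective xs!
    (trans (Any.lookup-index (xs⊆ys (∈-lookup i)))
      (trans (cong (lookup ys) eq) (sym (Any.lookup-index (xs⊆ys (∈-lookup j))))))

length-⊆⊇ : {xs ys : List A} → Unique xs → Unique ys → xs ⊆ ys → ys ⊆ xs → length xs ≡ length ys
length-⊆⊇ xs! ys! xs⊆ys ys⊆xs = ℕ.≤-antisym (length-mono-⊆ xs! xs⊆ys) (length-mono-⊆ ys! ys⊆xs)

-- An entry of `ys` missing from `xs` could be put in front of `xs`, giving a duplicate-free list
-- inside `ys` that is too long.
⊆∧length≥⇒⊇ : DecidableEquality A → {xs ys : List A} →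
  Unique xs → xs ⊆ ys → length ys ≤ length xs → ys ⊆ xs
⊆∧length≥⇒⊇ _≟_ {xs} {ys} xs! xs⊆ys ≥ {y} y∈ys with DecMembership._∈?_ _≟_ y xs
... | yes y∈xs = y∈xs
... | no  y∉xs = contradiction (ℕ.≤-trans (length-mono-⊆ y∷xs! y∷xs⊆ys) ≥) ℕ.1+n≰n
  where
  y∷xs! : Unique (y ∷ xs)
  y∷xs! = All.¬Any⇒All¬ xs y∉xs ∷ xs!
  y∷xs⊆ys : y ∷ xs ⊆ ys
  y∷xs⊆ys (here refl) = y∈ys
  y∷xs⊆ys (there p)   = xs⊆ys p

length-cartesianProduct : (xs : List A) (ys : List B) →
  length (cartesianProduct xs ys) ≡ length xs * length ys
length-cartesianProduct []       ys = refl
length-cartesianProduct (x ∷ xs) ys = trans (length-++ (map (x ,_) ys))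
  (cong₂ _+_ (length-map (x ,_) ys) (length-cartesianProduct xs ys))

map-unique : (f : A → B) {xs : List A} →
  (∀ {x y} → x ∈ˡ xs → y ∈ˡ xs → f x ≡ f y → x ≡ y) → Unique xs → Unique (map f xs)
map-unique f inj []         = []
map-unique f inj (x# ∷ xs!) =
  All.map⁺ (All.tabulate λ y∈ eq → All.lookup x# y∈ (inj (here refl) (there y∈) eq)) ∷
  map-unique f (λ p q → inj (there p) (there q)) xs!

-- This shows that a relabeling prescribed by its list of values is injective on the colors in use.
unique-map⇒injective : (f : A → B) {xs : List A} → Unique (map f xs) →
  ∀ {x y} → x ∈ˡ xs → y ∈ˡ xs → f x ≡ f y → x ≡ y
unique-map⇒injective f _          (here refl) (here refl) _  = refl
unique-map⇒injective f (x# ∷ _)   (here refl) (there y∈)  eq =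
  contradiction eq (All.lookup x# (∈-map⁺ f y∈))
unique-map⇒injective f (x# ∷ _)   (there x∈)  (here refl) eq =
  contradiction (sym eq) (All.lookup x# (∈-map⁺ f x∈))
unique-map⇒injective f (_ ∷ fxs!) (there x∈)  (there y∈)  eq =
  unique-map⇒injective f fxs! x∈ y∈ eq

-- The element of B only supplies the values of the function outside xs.
interpolate : DecidableEquality A → B → (xs : List A) (ys : List B) → Unique xs →
  length xs ≡ length ys → ∃[ f ] map f xs ≡ ys
interpolate _≟_ b []       []       _          _   = (λ _ → b) , refl
interpolate {A = A} {B = B} _≟_ b (x ∷ xs) (y ∷ ys) (x# ∷ xs!) len
  with g , eq ← interpolate _≟_ b xs ys xs! (ℕ.suc-injective len) =
  f , cong₂ _∷_ fx≡y (trans (map-cong-local (All.map f≡g x#)) eq)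
  where
  f : A → B
  f c with x ≟ c
  ... | yes _ = y
  ... | no  _ = g c
  fx≡y : f x ≡ y
  fx≡y with x ≟ x
  ... | yes _   = refl
  ... | no  x≢x = contradiction refl x≢x
  f≡g : ∀ {c} → x ≢ c → f c ≡ g c
  f≡g {c} x≢c with x ≟ c
  ... | yes x≡c = contradiction x≡c x≢c
  ... | no  _   = refl

-- Recovers the matching of single blocks from a matching of concatenated lists; the length equation
-- fixes where to cut.
map-++-injective : (f : A → B) (xs : List A) {xs′ : List A} {ys ys′ : List B} →
  length xs ≡ length ys → map f (xs ++ xs′) ≡ ys ++ ys′ → map f xs ≡ ys × map f xs′ ≡ ys′
map-++-injective f []       {ys = []}     _   eq = refl , eq
map-++-injective f (x ∷ xs) {ys = y ∷ ys} len eq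
  with fx≡y , eq′ ← ∷-injective eq
  with eq₁ , eq₂ ← map-++-injective f xs (ℕ.suc-injective len) eq′ = cong₂ _∷_ fx≡y eq₁ , eq₂

-- Subsets of Fin n

x∈p─q⇒x∉q : ∀ {x} (p q : Subset n) → x ∈ p ─ q → x ∉ q
x∈p─q⇒x∉q (_ ∷ p) (inside  ∷ q) (there x∈) (there x∈q) = x∈p─q⇒x∉q p q x∈ x∈q
x∈p─q⇒x∉q (_ ∷ p) (outside ∷ q) (there x∈) (there x∈q) = x∈p─q⇒x∉q p q x∈ x∈q

p≡p∩q∪p─q : (p q : Subset n) → p ≡ (p ∩ q) ∪ (p ─ q)
p≡p∩q∪p─q []            []            = refl
p≡p∩q∪p─q (inside  ∷ p) (inside  ∷ q) = cong (inside  ∷_) (p≡p∩q∪p─q p q)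
p≡p∩q∪p─q (inside  ∷ p) (outside ∷ q) = cong (inside  ∷_) (p≡p∩q∪p─q p q)
p≡p∩q∪p─q (outside ∷ p) (inside  ∷ q) = cong (outside ∷_) (p≡p∩q∪p─q p q)
p≡p∩q∪p─q (outside ∷ p) (outside ∷ q) = cong (outside ∷_) (p≡p∩q∪p─q p q)

∣p∩q∣+∣p─q∣≡∣p∣ : (p q : Subset n) → ∣ p ∩ q ∣ + ∣ p ─ q ∣ ≡ ∣ p ∣
∣p∩q∣+∣p─q∣≡∣p∣ []            []            = refl
∣p∩q∣+∣p─q∣≡∣p∣ (inside  ∷ p) (inside  ∷ q) = cong suc (∣p∩q∣+∣p─q∣≡∣p∣ p q)
∣p∩q∣+∣p─q∣≡∣p∣ (inside  ∷ p) (outside ∷ q) = trans (ℕ.+-suc _ _) (cong suc (∣p∩q∣+∣p─q∣≡∣p∣ p q))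
∣p∩q∣+∣p─q∣≡∣p∣ (outside ∷ p) (inside  ∷ q) = ∣p∩q∣+∣p─q∣≡∣p∣ p q
∣p∩q∣+∣p─q∣≡∣p∣ (outside ∷ p) (outside ∷ q) = ∣p∩q∣+∣p─q∣≡∣p∣ p q

-- Used to read off from a shape how many colors occur on one side only.
∣p─q∣≡ : (p q : Subset n) → ∀ {t d} → ∣ p ∩ q ∣ ≡ t → ∣ p ∣ ≡ t + d → ∣ p ─ q ∣ ≡ d
∣p─q∣≡ p q {d = d} refl ∣p∣≡ =
  ℕ.+-cancelˡ-≡ (∣ p ∩ q ∣) (∣ p ─ q ∣) d (trans (∣p∩q∣+∣p─q∣≡∣p∣ p q) ∣p∣≡)

p≡⁅x⁆∪⁅y⁆∪⁅z⁆ : (p q : Subset n) → ∀ {x y z} → p ∩ q ≡ ⁅ x ⁆ ∪ ⁅ y ⁆ → p ─ q ≡ ⁅ z ⁆ →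
  p ≡ ⁅ x ⁆ ∪ ⁅ y ⁆ ∪ ⁅ z ⁆
p≡⁅x⁆∪⁅y⁆∪⁅z⁆ p q ∩≡ ─≡ = trans (p≡p∩q∪p─q p q) (trans (cong₂ _∪_ ∩≡ ─≡) (∪-assoc ⁅ _ ⁆ ⁅ _ ⁆ ⁅ _ ⁆))

∣p∪q∣+∣p∩q∣≡∣p∣+∣q∣ : (p q : Subset n) → ∣ p ∪ q ∣ + ∣ p ∩ q ∣ ≡ ∣ p ∣ + ∣ q ∣
∣p∪q∣+∣p∩q∣≡∣p∣+∣q∣ []            []            = refl
∣p∪q∣+∣p∩q∣≡∣p∣+∣q∣ (inside  ∷ p) (inside  ∷ q) =
  cong suc (trans (ℕ.+-suc _ _) (trans (cong suc (∣p∪q∣+∣p∩q∣≡∣p∣+∣q∣ p q)) (sym (ℕ.+-suc _ _))))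
∣p∪q∣+∣p∩q∣≡∣p∣+∣q∣ (inside  ∷ p) (outside ∷ q) = cong suc (∣p∪q∣+∣p∩q∣≡∣p∣+∣q∣ p q)
∣p∪q∣+∣p∩q∣≡∣p∣+∣q∣ (outside ∷ p) (inside  ∷ q) =
  trans (cong suc (∣p∪q∣+∣p∩q∣≡∣p∣+∣q∣ p q)) (sym (ℕ.+-suc _ _))
∣p∪q∣+∣p∩q∣≡∣p∣+∣q∣ (outside ∷ p) (outside ∷ q) = ∣p∪q∣+∣p∩q∣≡∣p∣+∣q∣ p q

-- Listing a subset makes the pigeonhole lemmas for lists available and lets a map on it be
-- prescribed value by value.
elements : Subset n → List (Fin n)
elements []            = []
elements (inside  ∷ p) = zero ∷ map suc (elements p)
elements (outside ∷ p) = map suc (elements p)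

length-elements : (p : Subset n) → length (elements p) ≡ ∣ p ∣
length-elements []            = refl
length-elements (inside  ∷ p) = cong suc (trans (length-map suc (elements p)) (length-elements p))
length-elements (outside ∷ p) = trans (length-map suc (elements p)) (length-elements p)

∈-elements⁺ : ∀ {p : Subset n} {x} → x ∈ p → x ∈ˡ elements p
∈-elements⁺ {p = inside  ∷ p} here       = here refl
∈-elements⁺ {p = inside  ∷ p} (there x∈) = there (∈-map⁺ suc (∈-elements⁺ x∈))
∈-elements⁺ {p = outside ∷ p} (there x∈) = ∈-map⁺ suc (∈-elements⁺ x∈)

∈-elements⁻ : ∀ {p : Subset n} {x} → x ∈ˡ elements p → x ∈ p
∈-elements⁻ {p = inside  ∷ p} (here refl) = here
∈-elements⁻ {p = inside  ∷ p} (there x∈) with _ , y∈ , refl ← ∈-map⁻ suc x∈ = there (∈-elements⁻ y∈)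
∈-elements⁻ {p = outside ∷ p} x∈         with _ , y∈ , refl ← ∈-map⁻ suc x∈ = there (∈-elements⁻ y∈)

elements-unique : (p : Subset n) → Unique (elements p)
elements-unique []            = []
elements-unique (inside  ∷ p) =
  All.map⁺ (All.tabulate λ _ ()) ∷ Unique.map⁺ Fin.suc-injective (elements-unique p)
elements-unique (outside ∷ p) = Unique.map⁺ Fin.suc-injective (elements-unique p)

∣p∣≡length : {p : Subset n} {xs : List (Fin n)} → Unique xs →
  (∀ {x} → x ∈ p → x ∈ˡ xs) → (∀ {x} → x ∈ˡ xs → x ∈ p) → ∣ p ∣ ≡ length xs
∣p∣≡length {p = p} xs! p⊆xs xs⊆p = trans (sym (length-elements p))
  (length-⊆⊇ (elements-unique p) xs! (p⊆xs ∘ ∈-elements⁻) (∈-elements⁺ ∘ xs⊆p))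

0<∣p∣⇒∃∈ : (p : Subset n) → 0 < ∣ p ∣ → ∃[ x ] x ∈ p
0<∣p∣⇒∃∈ (inside  ∷ p) _   = zero , here
0<∣p∣⇒∃∈ (outside ∷ p) 0<p with x , x∈ ← 0<∣p∣⇒∃∈ p 0<p = suc x , there x∈

∣p∩q∣<∣p∣⇒∃∈p∉q : (p q : Subset n) → ∣ p ∩ q ∣ < ∣ p ∣ → ∃[ x ] x ∈ p × x ∉ q
∣p∩q∣<∣p∣⇒∃∈p∉q p q lt
  -- Cancel `∣ p ∩ q ∣` from `∣ p ∩ q ∣ + 0 < ∣ p ∩ q ∣ + ∣ p ─ q ∣`.
  with x , x∈ ← 0<∣p∣⇒∃∈ (p ─ q) (ℕ.+-cancelˡ-< (∣ p ∩ q ∣) 0 (∣ p ─ q ∣)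
    (subst₂ _<_ (sym (ℕ.+-identityʳ _)) (sym (∣p∩q∣+∣p─q∣≡∣p∣ p q)) lt)) =
  x , p─q⊆p p q x∈ , x∈p─q⇒x∉q p q x∈

-- Images of subsets under a map of colors

Image : (Fin m → Fin n) → Subset m → Subset n → Set
Image f S T = ∀ u → u ∈ T ⇔ (∃[ x ] x ∈ S × f x ≡ u)

Image-∪ : ∀ {f : Fin m → Fin n} {S S′ T T′} →
  Image f S T → Image f S′ T′ → Image f (S ∪ S′) (T ∪ T′)
Image-∪ {S = S} {S′} {T} {T′} im im′ u = mk⇔
  (λ u∈ → case x∈p∪q⁻ T T′ u∈ of λ where
    (inj₁ u∈T)  → let x , x∈ , eq = to (im u) u∈T in x , x∈p∪q⁺ (inj₁ x∈) , eq
    (inj₂ u∈T′) → let x , x∈ , eq = to (im′ u) u∈T′ in x , x∈p∪q⁺ (inj₂ x∈) , eq)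
  (λ (x , x∈ , eq) → x∈p∪q⁺ (Sum.map (λ x∈S → from (im u) (x , x∈S , eq))
    (λ x∈S′ → from (im′ u) (x , x∈S′ , eq)) (x∈p∪q⁻ S S′ x∈)))

Image-elements : ∀ {f : Fin m → Fin n} {S T} → map f (elements S) ≡ elements T → Image f S T
Image-elements {f = f} {S} {T} eq u = mk⇔
  (λ u∈T → let x , x∈ , u≡fx = ∈-map⁻ f (subst (u ∈ˡ_) (sym eq) (∈-elements⁺ u∈T))
           in x , ∈-elements⁻ x∈ , sym u≡fx)
  (λ { (x , x∈S , refl) → ∈-elements⁻ (subst (f x ∈ˡ_) eq (∈-map⁺ f (∈-elements⁺ x∈S))) })

-- By injectivity on `S`, the list `map f (elements S)` enumerates `T` without repetition.
∣Image∣ : ∀ {f : Fin m → Fin n} {S T} → Image f S T →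
  (∀ {x y} → x ∈ S → y ∈ S → f x ≡ f y → x ≡ y) → ∣ S ∣ ≡ ∣ T ∣
∣Image∣ {f = f} {S} {T} im inj = sym (trans
  (∣p∣≡length (map-unique f (λ x∈ y∈ → inj (∈-elements⁻ x∈) (∈-elements⁻ y∈)) (elements-unique S))
    (λ {u} u∈T → case to (im u) u∈T of λ { (x , x∈S , refl) → ∈-map⁺ f (∈-elements⁺ x∈S) })
    (λ {u} u∈ → let x , x∈ , eq = ∈-map⁻ f u∈ in from (im u) (x , ∈-elements⁻ x∈ , sym eq)))
  (trans (length-map f (elements S)) (length-elements S)))

-- Row and column colors

-- The two projections as `f` describe `R` and `K`; `id` rebuilds a subset from its list of
-- elements.
∈-⋃-singletons : (f : A → Fin n) (xs : List A) (c : Fin n) →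
  c ∈ ⋃ (map (⁅_⁆ ∘ f) xs) ⇔ (∃[ x ] x ∈ˡ xs × f x ≡ c)
∈-⋃-singletons f []       c = mk⇔ (λ c∈⊥ → contradiction c∈⊥ ∉⊥) λ ()
∈-⋃-singletons f (x ∷ xs) c = mk⇔
  (λ c∈ → case x∈p∪q⁻ ⁅ f x ⁆ _ c∈ of λ where
    (inj₁ c∈fx) → x , here refl , sym (x∈⁅y⁆⇒x≡y (f x) c∈fx)
    (inj₂ c∈xs) → let y , y∈ , eq = to (∈-⋃-singletons f xs c) c∈xs in y , there y∈ , eq)
  (λ { (_ , here refl , refl) → x∈p∪q⁺ (inj₁ (x∈⁅x⁆ (f x)))
     ; (y , there y∈ , eq)    → x∈p∪q⁺ (inj₂ (from (∈-⋃-singletons f xs c) (y , y∈ , eq))) })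

p≡⋃elements : (p : Subset n) → p ≡ ⋃ (map ⁅_⁆ (elements p))
p≡⋃elements p = ⊆-antisym
  (λ x∈p → from (∈-⋃-singletons id (elements p) _) (_ , ∈-elements⁺ x∈p , refl))
  (λ x∈⋃ → case to (∈-⋃-singletons id (elements p) _) x∈⋃ of λ { (_ , x∈ , refl) → ∈-elements⁻ x∈ })

∣p∣≡1⇒p≡⁅x⁆ : (p : Subset n) → ∣ p ∣ ≡ 1 → ∃[ x ] p ≡ ⁅ x ⁆
∣p∣≡1⇒p≡⁅x⁆ p ∣p∣≡1 with elements p | p≡⋃elements p | trans (length-elements p) ∣p∣≡1
-- The fold behind `⋃` ends in `⊥`, which `∪-identityʳ` removes.
... | x ∷ [] | p≡ | _ = x , trans p≡ (∪-identityʳ ⁅ x ⁆)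

∣p∣≡2⇒p≡⁅x⁆∪⁅y⁆ : (p : Subset n) → ∣ p ∣ ≡ 2 → ∃₂ λ x y → x ≢ y × p ≡ ⁅ x ⁆ ∪ ⁅ y ⁆
∣p∣≡2⇒p≡⁅x⁆∪⁅y⁆ p ∣p∣≡2
  with elements p | p≡⋃elements p | elements-unique p | trans (length-elements p) ∣p∣≡2
... | x ∷ y ∷ [] | p≡ | (x≢y ∷ []) ∷ _ | _ =
  x , y , x≢y , trans p≡ (cong (⁅ x ⁆ ∪_) (∪-identityʳ ⁅ y ⁆))

module _ (P : Configuration n) where

  ∈R⁻ : ∀ {x} → x ∈ R P → ∃[ y ] (x , y) ∈ᶜ P
  ∈R⁻ {x} x∈R with (_ , y) , xy∈P , refl ← to (∈-⋃-singletons proj₁ (pairs P) x) x∈R = y , xy∈P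

  ∈K⁻ : ∀ {y} → y ∈ K P → ∃[ x ] (x , y) ∈ᶜ P
  ∈K⁻ {y} y∈K with (x , _) , xy∈P , refl ← to (∈-⋃-singletons proj₂ (pairs P) y) y∈K = x , xy∈P

  ∈R⁺ : ∀ {x y} → (x , y) ∈ᶜ P → x ∈ R P
  ∈R⁺ xy∈P = from (∈-⋃-singletons proj₁ (pairs P) _) (_ , xy∈P , refl)

  ∈K⁺ : ∀ {x y} → (x , y) ∈ᶜ P → y ∈ K P
  ∈K⁺ xy∈P = from (∈-⋃-singletons proj₂ (pairs P) _) (_ , xy∈P , refl)

  ∈ᶜ⇒≢ : ∀ {x y} → (x , y) ∈ᶜ P → x ≢ y
  ∈ᶜ⇒≢ = All.lookup (distinct P)

  R-interchange : R (interchange P) ≡ K P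
  R-interchange = cong ⋃ (sym (map-∘ (pairs P)))

  K-interchange : K (interchange P) ≡ R P
  K-interchange = cong ⋃ (sym (map-∘ (pairs P)))

  -- A relabeling preserves these three numbers, and they determine a nonempty saturated
  -- configuration up to relabeling.
  shape : ℕ × ℕ × ℕ
  shape = ∣ R P ∣ , ∣ K P ∣ , ∣ R P ∩ K P ∣

  Saturated : Set
  Saturated = ∀ {x y} → x ∈ R P → y ∈ K P → x ≢ y → (x , y) ∈ᶜ P

  -- Adjoining the missing diagonal pairs to P gives a subset of R P × K P,
  -- which is all of it exactly when P is saturated.
  private
    diagonal filled grid : List (Fin n × Fin n)
    diagonal = map (λ c → c , c) (elements (R P ∩ K P))
    filled   = pairs P ++ diagonal
    grid     = cartesianProduct (elements (R P)) (elements (K P))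

    filled-unique : Unique filled
    filled-unique = Unique.++⁺ (unique P)
      (Unique.map⁺ (cong proj₁) (elements-unique (R P ∩ K P)))
      (λ (p∈P , p∈diagonal) → case ∈-map⁻ _ p∈diagonal of λ { (_ , _ , refl) → ∈ᶜ⇒≢ p∈P refl })

    grid-unique : Unique grid
    grid-unique = Unique.cartesianProduct⁺ (elements-unique (R P)) (elements-unique (K P))

    filled⊆grid : filled ⊆ grid
    filled⊆grid p∈ with ∈-++⁻ (pairs P) p∈
    ... | inj₁ p∈P = ∈-cartesianProduct⁺ (∈-elements⁺ (∈R⁺ p∈P)) (∈-elements⁺ (∈K⁺ p∈P))
    ... | inj₂ p∈diagonal with c , c∈ , refl ← ∈-map⁻ _ p∈diagonal
      with c∈R , c∈K ← x∈p∩q⁻ (R P) (K P) (∈-elements⁻ c∈) =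
      ∈-cartesianProduct⁺ (∈-elements⁺ c∈R) (∈-elements⁺ c∈K)

    length-filled : length filled ≡ e P + ∣ R P ∩ K P ∣
    length-filled = trans (length-++ (pairs P))
      (cong (e P +_) (trans (length-map _ (elements (R P ∩ K P))) (length-elements (R P ∩ K P))))

    length-grid : length grid ≡ ∣ R P ∣ * ∣ K P ∣
    length-grid = trans (length-cartesianProduct (elements (R P)) (elements (K P)))
      (cong₂ _*_ (length-elements (R P)) (length-elements (K P)))

  e+∣R∩K∣≤∣R∣*∣K∣ : e P + ∣ R P ∩ K P ∣ ≤ ∣ R P ∣ * ∣ K P ∣
  e+∣R∩K∣≤∣R∣*∣K∣ = subst₂ _≤_ length-filled length-grid (length-mono-⊆ filled-unique filled⊆grid)

  e+∣R∩K∣≡∣R∣*∣K∣ : Saturated → e P + ∣ R P ∩ K P ∣ ≡ ∣ R P ∣ * ∣ K P ∣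
  e+∣R∩K∣≡∣R∣*∣K∣ sat = subst₂ _≡_ length-filled length-grid
    (length-⊆⊇ filled-unique grid-unique filled⊆grid grid⊆filled)
    where
    grid⊆filled : grid ⊆ filled
    grid⊆filled {x , y} p∈
      with x∈ , y∈ ← ∈-cartesianProduct⁻ (elements (R P)) (elements (K P)) p∈
      with x Fin.≟ y
    ... | yes refl = ∈-++⁺ʳ (pairs P)
      (∈-map⁺ _ (∈-elements⁺ (x∈p∩q⁺ (∈-elements⁻ {p = R P} x∈ , ∈-elements⁻ {p = K P} y∈))))
    ... | no  x≢y  = ∈-++⁺ˡ (sat (∈-elements⁻ x∈) (∈-elements⁻ y∈) x≢y)

  -- The bound says that `grid` is no longer than `filled`, so every pair of `grid` lies in
  -- `filled`; off the diagonal it can only come from `P`.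
  saturated : ∣ R P ∣ * ∣ K P ∣ ≤ e P + ∣ R P ∩ K P ∣ → Saturated
  saturated full x∈R y∈K x≢y
    with ∈-++⁻ (pairs P) (⊆∧length≥⇒⊇ (≡-dec Fin._≟_ Fin._≟_) filled-unique filled⊆grid
      (subst₂ _≤_ (sym length-grid) (sym length-filled) full)
      (∈-cartesianProduct⁺ (∈-elements⁺ x∈R) (∈-elements⁺ y∈K)))
  ... | inj₁ xy∈P = xy∈P
  ... | inj₂ p∈diagonal with _ , _ , refl ← ∈-map⁻ _ p∈diagonal = contradiction refl x≢y

  saturated⇒connected : Saturated → ∣ R P ∩ K P ∣ < ∣ R P ∣ → ∣ R P ∩ K P ∣ < ∣ K P ∣ → Connected P
  saturated⇒connected sat t<r t<k
    with a , a∈R , a∉K ← ∣p∩q∣<∣p∣⇒∃∈p∉q (R P) (K P) t<r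
    with b , b∈K , b∉R ← ∣p∩q∣<∣p∣⇒∃∈p∉q (K P) (R P)
      (subst (_< ∣ K P ∣) (cong ∣_∣ (∩-comm (R P) (K P))) t<k) =
    λ u w u∈ w∈ → toRow u u∈ ◅◅ Eq.symmetric (Edge P) (toRow w w∈)
    where
    toRow : ∀ u → IsVertex P u → EqClosure (Edge P) u (inj₁ a)
    -- Row `x` reaches row `a` through column `b`, which differs from both since `b` is not a row
    -- color. A column is adjacent to row `a` itself, since `a` is not a column color.
    toRow (inj₁ x) x∈R =
      Eq.return (edge (sat x∈R b∈K λ { refl → b∉R x∈R })) ◅◅
      Eq.symmetric (Edge P) (Eq.return (edge (sat a∈R b∈K λ { refl → b∉R a∈R })))
    toRow (inj₂ y) y∈K = Eq.symmetric (Edge P) (Eq.return (edge (sat a∈R y∈K λ { refl → a∉K y∈K })))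

shape-interchange : (P : Configuration n) → ∀ {r k t} → shape P ≡ (r , k , t) →
  shape (interchange P) ≡ (k , r , t)
shape-interchange P refl rewrite R-interchange P | K-interchange P | ∩-comm (K P) (R P) = refl

-- Two expressions for the shape of `interchange P` are compared, because interchanging twice does
-- not give back `P` definitionally.
shape-interchange⁻ : (P : Configuration n) → ∀ {r k t} → shape (interchange P) ≡ (r , k , t) →
  shape P ≡ (k , r , t)
shape-interchange⁻ P eq with refl ← trans (sym eq) (shape-interchange P refl) = refl

saturated-interchange⁺ : (P : Configuration n) → Saturated P → Saturated (interchange P)
saturated-interchange⁺ P sat x∈ y∈ x≢y = ∈-map⁺ swap
  (sat (subst (_ ∈_) (K-interchange P) y∈) (subst (_ ∈_) (R-interchange P) x∈) (x≢y ∘ sym))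

saturated-interchange⁻ : (P : Configuration n) → Saturated (interchange P) → Saturated P
saturated-interchange⁻ P sat x∈R y∈K x≢y
  with _ , xy∈P , refl ← ∈-map⁻ swap (sat (subst (_ ∈_) (sym (R-interchange P)) y∈K)
    (subst (_ ∈_) (sym (K-interchange P)) x∈R) (x≢y ∘ sym)) = xy∈P

-- Relabelings

relabels-refl : (P : Configuration n) → Relabels id P P
relabels-refl P = (λ _ _ → id) ,
  λ u w → mk⇔ (λ uw∈ → u , w , uw∈ , refl , refl) (λ { (_ , _ , uw∈ , refl , refl) → uw∈ })

module _ {f : Fin m → Fin n} (P : Configuration m) (Q : Configuration n) where

  -- Saturated configurations are determined by their row and column colors, so it suffices to match
  -- these. Injectivity on the whole union keeps off-diagonal pairs off the diagonal.
  relabels⁺ : Saturated P → Saturated Q →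
    (∀ {c d} → c ∈ R P ∪ K P → d ∈ R P ∪ K P → f c ≡ f d → c ≡ d) →
    Image f (R P) (R Q) → Image f (K P) (K Q) → Relabels f P Q
  relabels⁺ satP satQ inj imR imK = inj , λ u w → mk⇔
    (λ uw∈Q → let x , x∈R , fx≡u = to (imR u) (∈R⁺ Q uw∈Q)
                  y , y∈K , fy≡w = to (imK w) (∈K⁺ Q uw∈Q)
              in x , y ,
                 satP x∈R y∈K (λ x≡y → ∈ᶜ⇒≢ Q uw∈Q (trans (sym fx≡u) (trans (cong f x≡y) fy≡w))) ,
                 fx≡u , fy≡w)
    (λ { (x , y , xy∈P , refl , refl) →
      satQ (from (imR _) (x , ∈R⁺ P xy∈P , refl)) (from (imK _) (y , ∈K⁺ P xy∈P , refl))
        (∈ᶜ⇒≢ P xy∈P ∘ inj (x∈p∪q⁺ (inj₁ (∈R⁺ P xy∈P))) (x∈p∪q⁺ (inj₂ (∈K⁺ P xy∈P)))) })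

  module _ (relabels : Relabels f P Q) where
    private
      inj = proj₁ relabels

      imageR : Image f (R P) (R Q)
      imageR u = mk⇔
        (λ u∈R → let w , uw∈Q = ∈R⁻ Q u∈R
                     x , _ , xy∈P , fx≡u , _ = to (proj₂ relabels u w) uw∈Q
                 in x , ∈R⁺ P xy∈P , fx≡u)
        (λ (x , x∈R , fx≡u) → let y , xy∈P = ∈R⁻ P x∈R in
          ∈R⁺ Q (from (proj₂ relabels u (f y)) (x , y , xy∈P , fx≡u , refl)))

      imageK : Image f (K P) (K Q)
      imageK w = mk⇔
        (λ w∈K → let u , uw∈Q = ∈K⁻ Q w∈K
                     _ , y , xy∈P , _ , fy≡w = to (proj₂ relabels u w) uw∈Q
                 in y , ∈K⁺ P xy∈P , fy≡w)
        (λ (y , y∈K , fy≡w) → let x , xy∈P = ∈K⁻ P y∈K in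
          ∈K⁺ Q (from (proj₂ relabels (f x) w) (x , y , xy∈P , refl , fy≡w)))

      imageR∩K : Image f (R P ∩ K P) (R Q ∩ K Q)
      imageR∩K u = mk⇔ forth
        (λ (x , x∈ , fx≡u) → let x∈R , x∈K = x∈p∩q⁻ (R P) (K P) x∈ in
          x∈p∩q⁺ (from (imageR u) (x , x∈R , fx≡u) , from (imageK u) (x , x∈K , fx≡u)))
        where
        forth : u ∈ R Q ∩ K Q → ∃[ x ] x ∈ R P ∩ K P × f x ≡ u
        forth u∈ with u∈R , u∈K ← x∈p∩q⁻ (R Q) (K Q) u∈
          with x , x∈R , fx≡u ← to (imageR u) u∈R
          with y , y∈K , fy≡u ← to (imageK u) u∈K
          -- The preimages of `u` in `R P` and in `K P` coincide, by injectivity across the two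
          -- sides.
          with refl ← inj (x∈p∪q⁺ (inj₁ x∈R)) (x∈p∪q⁺ (inj₂ y∈K)) (trans fx≡u (sym fy≡u)) =
          x , x∈p∩q⁺ (x∈R , y∈K) , fx≡u

    relabels⇒shape≡ : shape P ≡ shape Q
    relabels⇒shape≡ = cong₂ _,_
      (∣Image∣ imageR λ c∈ d∈ → inj (x∈p∪q⁺ (inj₁ c∈)) (x∈p∪q⁺ (inj₁ d∈)))
      (cong₂ _,_
        (∣Image∣ imageK λ c∈ d∈ → inj (x∈p∪q⁺ (inj₂ c∈)) (x∈p∪q⁺ (inj₂ d∈)))
        (∣Image∣ imageR∩K λ c∈ d∈ → inj (x∈p∪q⁺ (inj₁ (p∩q⊆p (R P) (K P) c∈)))
                                        (x∈p∪q⁺ (inj₁ (p∩q⊆p (R P) (K P) d∈)))))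

    -- The pair of images is off the diagonal, hence in `Q`. It comes from a pair of `P`, which
    -- injectivity identifies with `(x , y)`.
    saturated-relabels⁻ : Saturated Q → Saturated P
    saturated-relabels⁻ sat {x} {y} x∈R y∈K x≢y
      with x′ , y′ , xy∈P , fx≡ , fy≡ ← to (proj₂ relabels (f x) (f y))
        (sat (from (imageR (f x)) (x , x∈R , refl)) (from (imageK (f y)) (y , y∈K , refl))
          (x≢y ∘ inj (x∈p∪q⁺ (inj₁ x∈R)) (x∈p∪q⁺ (inj₂ y∈K))))
      with refl ← inj (x∈p∪q⁺ (inj₁ (∈R⁺ P xy∈P))) (x∈p∪q⁺ (inj₁ x∈R)) fx≡
      with refl ← inj (x∈p∪q⁺ (inj₂ (∈K⁺ P xy∈P))) (x∈p∪q⁺ (inj₂ y∈K)) fy≡ = xy∈P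

private
  -- The used colors are split into blocks by the sides on which they occur. The shape fixes the
  -- block lengths, so lists for equal shapes can be matched block by block.
  both onlyR onlyK colors : Configuration n → List (Fin n)
  both   P = elements (R P ∩ K P)
  onlyR  P = elements (R P ─ K P)
  onlyK  P = elements (K P ─ R P)
  colors P = both P ++ onlyR P ++ onlyK P

  colors-unique : (P : Configuration n) → Unique (colors P)
  colors-unique P = Unique.++⁺ (elements-unique (R P ∩ K P))
    (Unique.++⁺ (elements-unique (R P ─ K P)) (elements-unique (K P ─ R P))
      λ (c∈R─K , c∈K─R) →
        x∈p─q⇒x∉q (R P) (K P) (∈-elements⁻ c∈R─K) (p─q⊆p (K P) (R P) (∈-elements⁻ c∈K─R)))
    λ (c∈R∩K , c∈rest) → let c∈R , c∈K = x∈p∩q⁻ (R P) (K P) (∈-elements⁻ c∈R∩K) in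
      [ (λ c∈R─K → x∈p─q⇒x∉q (R P) (K P) (∈-elements⁻ c∈R─K) c∈K)
      , (λ c∈K─R → x∈p─q⇒x∉q (K P) (R P) (∈-elements⁻ c∈K─R) c∈R)
      ]′ (∈-++⁻ (onlyR P) c∈rest)

  ∈-colors : (P : Configuration n) → ∀ {c} → c ∈ R P ∪ K P → c ∈ˡ colors P
  ∈-colors P {c} c∈ with c ∈? R P | c ∈? K P
  ... | yes c∈R | yes c∈K = ∈-++⁺ˡ (∈-elements⁺ (x∈p∩q⁺ (c∈R , c∈K)))
  ... | yes c∈R | no  c∉K = ∈-++⁺ʳ (both P) (∈-++⁺ˡ (∈-elements⁺ (x∈p∧x∉q⇒x∈p─q c∈R c∉K)))
  ... | no  c∉R | yes c∈K =
    ∈-++⁺ʳ (both P) (∈-++⁺ʳ (onlyR P) (∈-elements⁺ (x∈p∧x∉q⇒x∈p─q c∈K c∉R)))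
  ... | no  c∉R | no  c∉K = contradiction (x∈p∪q⁻ (R P) (K P) c∈) [ c∉R , c∉K ]′

  length-elements-≡ : {p : Subset m} {q : Subset n} → ∣ p ∣ ≡ ∣ q ∣ →
    length (elements p) ≡ length (elements q)
  length-elements-≡ {p = p} {q} eq = trans (length-elements p) (trans eq (sym (length-elements q)))

-- A map carrying each block of `colors P` to the corresponding block of `colors Q` carries `R P` to
-- `R Q` and `K P` to `K Q`, as these are unions of blocks. It is injective because its values form
-- the duplicate-free list `colors Q`.
saturated∧shape≡⇒∼ : (P : Configuration m) (Q : Configuration n) → Saturated P → Saturated Q →
  0 < ∣ R Q ∣ → shape P ≡ shape Q → P ∼ Q
saturated∧shape≡⇒∼ P Q satP satQ 0<r shape≡
  with r≡ , kt≡ ← ,-injective shape≡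
  with k≡ , t≡ ← ,-injective kt≡
  with len-both ← length-elements-≡ {p = R P ∩ K P} {R Q ∩ K Q} t≡
     | len-R ← length-elements-≡ {p = R P ─ K P} {R Q ─ K Q}
         (∣p─q∣≡ (R P) (K P) t≡ (trans r≡ (sym (∣p∩q∣+∣p─q∣≡∣p∣ (R Q) (K Q)))))
     | len-K ← length-elements-≡ {p = K P ─ R P} {K Q ─ R Q} (∣p─q∣≡ (K P) (R P)
         (trans (cong ∣_∣ (∩-comm (K P) (R P))) (trans t≡ (cong ∣_∣ (∩-comm (R Q) (K Q)))))
         (trans k≡ (sym (∣p∩q∣+∣p─q∣≡∣p∣ (K Q) (R Q)))))
  -- A row color of `Q` serves as the default value on colors that `P` does not use.
  with f , f-colors ← interpolate Fin._≟_ (proj₁ (0<∣p∣⇒∃∈ (R Q) 0<r)) (colors P) (colors Q)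
         (colors-unique P)
         (trans (length-++ (both P)) (trans (cong₂ _+_ len-both
           (trans (length-++ (onlyR P)) (trans (cong₂ _+_ len-R len-K) (sym (length-++ (onlyR Q))))))
           (sym (length-++ (both Q)))))
  with f-both , f-rest ← map-++-injective f (both P) len-both f-colors
  with f-R , f-K ← map-++-injective f (onlyR P) len-R f-rest
  with image∩ ← Image-elements {f = f} {R P ∩ K P} {R Q ∩ K Q} f-both =
  inj₁ (f , relabels⁺ P Q satP satQ
    (λ c∈ d∈ → unique-map⇒injective f (subst Unique (sym f-colors) (colors-unique Q))
      (∈-colors P c∈) (∈-colors P d∈))
    (subst₂ (Image f) (sym (p≡p∩q∪p─q (R P) (K P))) (sym (p≡p∩q∪p─q (R Q) (K Q)))
      (Image-∪ image∩ (Image-elements f-R)))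
    (subst₂ (Image f) (sym (p≡p∩q∪p─q (K P) (R P))) (sym (p≡p∩q∪p─q (K Q) (R Q)))
      (Image-∪ (subst₂ (Image f) (∩-comm (R P) (K P)) (∩-comm (R Q) (K Q)) image∩)
        (Image-elements f-K))))

-- Extremal shapes

Tight : ℕ × ℕ × ℕ → Set
Tight σ = σ ≡ (2 , 3 , 0) ⊎ σ ≡ (3 , 2 , 0) ⊎ σ ≡ (3 , 3 , 2)

-- The third condition is `e + t ≤ r * k` with `e = r + k + 1`. The last is `e + s ≤ 11` with `t`
-- added to both sides, so that `s + t = r + k` replaces a subtraction.
Light : ℕ × ℕ × ℕ → Set
Light (r , k , t) = t ≤ r × t ≤ k × r + k + 1 + t ≤ r * k × r + k + 1 + (r + k) ≤ 11 + t

-- A finite check: the 216 triples below the bounds are decided by evaluation.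
light⇒tight : ∀ {r} → r < 6 → ∀ {k} → k < 6 → ∀ {t} → t < 6 → Light (r , k , t) → Tight (r , k , t)
light⇒tight = from-yes
  (allUpTo? (λ r → allUpTo? (λ k → allUpTo? (λ t →
    ((t ℕ.≤? r) ×-dec (t ℕ.≤? k) ×-dec (r + k + 1 + t ℕ.≤? r * k)
      ×-dec (r + k + 1 + (r + k) ℕ.≤? 11 + t))
    →-dec (_≟_ (r , k , t) (2 , 3 , 0) ⊎-dec _≟_ (r , k , t) (3 , 2 , 0)
      ⊎-dec _≟_ (r , k , t) (3 , 3 , 2))) 6) 6) 6)
  where _≟_ = ≡-dec ℕ._≟_ (≡-dec ℕ._≟_ ℕ._≟_)

-- The strict inequalities serve connectedness, the first equation links saturation with
-- `e = v + 1`, and the second yields the value 11.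
tight⇒balanced : ∀ {r k t} → Tight (r , k , t) →
  t < r × t < k × r * k ≡ r + k + 1 + t × r + k + 1 + (r + k) ≡ 11 + t
tight⇒balanced (inj₁ refl)        = s≤s z≤n , s≤s z≤n , refl , refl
tight⇒balanced (inj₂ (inj₁ refl)) = s≤s z≤n , s≤s z≤n , refl , refl
tight⇒balanced (inj₂ (inj₂ refl)) = s≤s (s≤s (s≤s z≤n)) , s≤s (s≤s (s≤s z≤n)) , refl , refl

module _ (P : Configuration n) where

  s+∣R∩K∣≡v : s P + ∣ R P ∩ K P ∣ ≡ v P
  s+∣R∩K∣≡v = ∣p∪q∣+∣p∩q∣≡∣p∣+∣q∣ (R P) (K P)

  bicyclic⇒tight : Bicyclic P → e P + s P ≤ 11 → Tight (shape P)
  bicyclic⇒tight (_ , e≡) e+s≤11 =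
    light⇒tight (<6 r≤s (ℕ.m≤m+n r k)) (<6 k≤s (ℕ.m≤n+m k r))
      (ℕ.≤-<-trans (∣p∩q∣≤∣p∣ (R P) (K P)) (<6 r≤s (ℕ.m≤m+n r k)))
      ( ∣p∩q∣≤∣p∣ (R P) (K P)
      , ∣p∩q∣≤∣q∣ (R P) (K P)
      , subst (λ ℓ → ℓ + t ≤ r * k) e≡ (e+∣R∩K∣≤∣R∣*∣K∣ P)
      , subst (_≤ 11 + t) (trans (ℕ.+-assoc (e P) (s P) t) (cong₂ _+_ e≡ s+∣R∩K∣≡v))
          (ℕ.+-monoˡ-≤ t e+s≤11))
    where
    r = ∣ R P ∣
    k = ∣ K P ∣
    t = ∣ R P ∩ K P ∣
    r≤s : r ≤ s P
    r≤s = ∣p∣≤∣p∪q∣ (R P) (K P)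
    k≤s : k ≤ s P
    k≤s = ∣q∣≤∣p∪q∣ (R P) (K P)
    -- A count of at least 6 would force both `e P`, which exceeds `v P`, and `s P` to be at least
    -- 6, against a sum of at most 11.
    <6 : ∀ {c} → c ≤ s P → c ≤ r + k → c < 6
    <6 {c} c≤s c≤v = ℕ.≰⇒> λ 6≤c → ℕ.<⇒≱ (ℕ.n<1+n 11) (ℕ.≤-trans
      (ℕ.+-mono-≤ (ℕ.≤-trans 6≤c (ℕ.≤-trans c≤v (subst (v P ≤_) (sym e≡) (ℕ.m≤m+n (v P) 1))))
        (ℕ.≤-trans 6≤c c≤s)) e+s≤11)

  tight⇒bicyclic : Saturated P → Tight (shape P) → Bicyclic P × e P + s P ≡ 11
  tight⇒bicyclic sat tight
    with t<r , t<k , _ , sum≡ ← tight⇒balanced tight =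
    (saturated⇒connected P sat t<r t<k , e≡) ,
    ℕ.+-cancelʳ-≡ t (e P + s P) 11
      (trans (ℕ.+-assoc (e P) (s P) t) (trans (cong₂ _+_ e≡ s+∣R∩K∣≡v) sum≡))
    where
    t = ∣ R P ∩ K P ∣
    -- After adding `t`, both sides equal `∣ R P ∣ * ∣ K P ∣`: the left by saturation, the right by
    -- tightness.
    e≡ : e P ≡ v P + 1
    e≡ = ℕ.+-cancelʳ-≡ t (e P) (v P + 1)
      (trans (e+∣R∩K∣≡∣R∣*∣K∣ P sat) (proj₁ (proj₂ (proj₂ (tight⇒balanced tight)))))

  bicyclic⇒saturated : Bicyclic P → Tight (shape P) → Saturated P
  bicyclic⇒saturated (_ , e≡) tight with _ , _ , r*k≡ , _ ← tight⇒balanced tight =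
    saturated P (ℕ.≤-reflexive (trans r*k≡ (cong (_+ ∣ R P ∩ K P ∣) (sym e≡))))

  -- If the sum is at most 11, the shape is tight and `P` is saturated, which makes the sum exactly
  -- 11.
  bicyclic⇒11≤e+s : Bicyclic P → 11 ≤ e P + s P
  bicyclic⇒11≤e+s bi with ℕ.≤-total 11 (e P + s P)
  ... | inj₁ 11≤ = 11≤
  ... | inj₂ ≤11 with tight ← bicyclic⇒tight bi ≤11 =
    ℕ.≤-reflexive (sym (proj₂ (tight⇒bicyclic (bicyclic⇒saturated bi tight) tight)))

  -- The two extremal forms and their shapes

  completeForm⇒saturated : CompleteForm P → Saturated P
  completeForm⇒saturated (_ , _ , _ , mem) x∈R y∈K _ = from (mem _ _) (x∈R , y∈K)

  completeForm⇒shape : CompleteForm P → shape P ≡ (2 , 3 , 0)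
  completeForm⇒shape (r≡ , k≡ , ∩≡⊥ , _) =
    cong₂ _,_ r≡ (cong₂ _,_ k≡ (trans (cong ∣_∣ ∩≡⊥) (∣⊥∣≡0 n)))

  -- Without a shared color all of `R P` times `K P` is off the diagonal, so saturation yields the
  -- full product.
  shape⇒completeForm : Saturated P → shape P ≡ (2 , 3 , 0) → CompleteForm P
  shape⇒completeForm sat shape≡
    with r≡ , kt≡ ← ,-injective shape≡
    with k≡ , t≡ ← ,-injective kt≡ =
    r≡ , k≡ , Empty-unique disjoint , λ u w → mk⇔
      (λ uw∈P → ∈R⁺ P uw∈P , ∈K⁺ P uw∈P)
      (λ (u∈R , w∈K) → sat u∈R w∈K λ { refl → disjoint (u , x∈p∩q⁺ (u∈R , w∈K)) })
    where
    disjoint : Empty (R P ∩ K P)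
    disjoint (_ , c∈) = ℕ.<⇒≢ (subst (0 <_) (length-elements (R P ∩ K P)) (∈-length (∈-elements⁺ c∈)))
      (sym (cong (proj₂ ∘ proj₂) shape≡))

  deletedForm⇒saturated : DeletedForm P → Saturated P
  deletedForm⇒saturated (_ , _ , _ , _ , _ , _ , _ , _ , _ , _ , mem) x∈R y∈K x≢y =
    from (mem _ _) (x∈R , y∈K , (λ { refl → x≢y refl }) , (λ { refl → x≢y refl }))

  deletedForm⇒shape : DeletedForm P → shape P ≡ (3 , 3 , 2)
  deletedForm⇒shape (a , b , x , y , a≢b , x≢y , x∉ab , y∉ab , R≡ , K≡ , _) =
    cong₂ _,_ (∣triple∣ R≡ x∉ab) (cong₂ _,_ (∣triple∣ K≡ y∉ab)
      (∣p∣≡length {xs = a ∷ b ∷ []} ((a≢b ∷ []) ∷ [] ∷ []) common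
        λ { (here refl)         → x∈p∩q⁺ (∈triple R≡ (here refl) , ∈triple K≡ (here refl))
          ; (there (here refl)) →
              x∈p∩q⁺ (∈triple R≡ (there (here refl)) , ∈triple K≡ (there (here refl))) }))
    where
    triple∋ : ∀ {p z} → p ≡ ⁅ a ⁆ ∪ ⁅ b ⁆ ∪ ⁅ z ⁆ → ∀ {c} → c ∈ p → c ∈ˡ a ∷ b ∷ z ∷ []
    triple∋ {z = z} refl c∈ with x∈p∪q⁻ ⁅ a ⁆ (⁅ b ⁆ ∪ ⁅ z ⁆) c∈
    ... | inj₁ c∈a = here (x∈⁅y⁆⇒x≡y a c∈a)
    ... | inj₂ c∈bz with x∈p∪q⁻ ⁅ b ⁆ ⁅ z ⁆ c∈bz
    ...   | inj₁ c∈b = there (here (x∈⁅y⁆⇒x≡y b c∈b))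
    ...   | inj₂ c∈z = there (there (here (x∈⁅y⁆⇒x≡y z c∈z)))
    ∈triple : ∀ {p z} → p ≡ ⁅ a ⁆ ∪ ⁅ b ⁆ ∪ ⁅ z ⁆ → ∀ {c} → c ∈ˡ a ∷ b ∷ z ∷ [] → c ∈ p
    ∈triple refl (here refl)                 = x∈p∪q⁺ (inj₁ (x∈⁅x⁆ _))
    ∈triple refl (there (here refl))         = x∈p∪q⁺ (inj₂ (x∈p∪q⁺ (inj₁ (x∈⁅x⁆ _))))
    ∈triple refl (there (there (here refl))) = x∈p∪q⁺ (inj₂ (x∈p∪q⁺ (inj₂ (x∈⁅x⁆ _))))
    ∣triple∣ : ∀ {p z} → p ≡ ⁅ a ⁆ ∪ ⁅ b ⁆ ∪ ⁅ z ⁆ → z ∉ ⁅ a ⁆ ∪ ⁅ b ⁆ → ∣ p ∣ ≡ 3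
    ∣triple∣ p≡ z∉ab = ∣p∣≡length
      ((a≢b ∷ (λ { refl → z∉ab (x∈p∪q⁺ (inj₁ (x∈⁅x⁆ _))) }) ∷ []) ∷
       ((λ { refl → z∉ab (x∈p∪q⁺ (inj₂ (x∈⁅x⁆ _))) }) ∷ []) ∷ [] ∷ [])
      (triple∋ p≡) (∈triple p≡)
    -- A shared color other than `a` and `b` would equal both `x` and `y`.
    common : ∀ {c} → c ∈ R P ∩ K P → c ∈ˡ a ∷ b ∷ []
    common c∈ with c∈R , c∈K ← x∈p∩q⁻ (R P) (K P) c∈ with triple∋ R≡ c∈R | triple∋ K≡ c∈K
    ... | here eq                 | _                       = here eq
    ... | there (here eq)         | _                       = there (here eq)
    ... | _                       | here eq                 = here eq
    ... | _                       | there (here eq)         = there (here eq)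
    ... | there (there (here eq)) | there (there (here eq′)) = contradiction (trans (sym eq) eq′) x≢y

  -- Take `a` and `b` to be the shared colors, `x` the color only in rows and `y` the one only in
  -- columns. The diagonal pairs of the product are then exactly `(a , a)` and `(b , b)`.
  shape⇒deletedForm : Saturated P → shape P ≡ (3 , 3 , 2) → DeletedForm P
  shape⇒deletedForm sat shape≡
    with r≡ , kt≡ ← ,-injective shape≡
    with k≡ , t≡ ← ,-injective kt≡
    with a , b , a≢b , R∩K≡ ← ∣p∣≡2⇒p≡⁅x⁆∪⁅y⁆ (R P ∩ K P) t≡
    with x , R─K≡ ← ∣p∣≡1⇒p≡⁅x⁆ (R P ─ K P) (∣p─q∣≡ (R P) (K P) t≡ r≡)
    with K∩R≡ ← trans (∩-comm (K P) (R P)) R∩K≡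
    with y , K─R≡ ← ∣p∣≡1⇒p≡⁅x⁆ (K P ─ R P)
           (∣p─q∣≡ (K P) (R P) (trans (cong ∣_∣ (∩-comm (K P) (R P))) t≡) k≡)
    with x∈ ← subst (x ∈_) (sym R─K≡) (x∈⁅x⁆ x) | y∈ ← subst (y ∈_) (sym K─R≡) (x∈⁅x⁆ y) =
    a , b , x , y , a≢b ,
    (λ { refl → x∈p─q⇒x∉q (R P) (K P) x∈ (p─q⊆p (K P) (R P) y∈) }) ,
    (λ x∈ab → x∈p─q⇒x∉q (R P) (K P) x∈
      (proj₂ (x∈p∩q⁻ (R P) (K P) (subst (x ∈_) (sym R∩K≡) x∈ab)))) ,
    (λ y∈ab → x∈p─q⇒x∉q (K P) (R P) y∈
      (proj₁ (x∈p∩q⁻ (R P) (K P) (subst (y ∈_) (sym R∩K≡) y∈ab)))) ,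
    p≡⁅x⁆∪⁅y⁆∪⁅z⁆ (R P) (K P) R∩K≡ R─K≡ ,
    p≡⁅x⁆∪⁅y⁆∪⁅z⁆ (K P) (R P) K∩R≡ K─R≡ ,
    λ u w → mk⇔
      (λ uw∈P → ∈R⁺ P uw∈P , ∈K⁺ P uw∈P ,
        (λ { refl → ∈ᶜ⇒≢ P uw∈P refl }) , (λ { refl → ∈ᶜ⇒≢ P uw∈P refl }))
      (λ (u∈R , w∈K , ≢aa , ≢bb) → sat u∈R w∈K λ { refl →
        case x∈p∪q⁻ ⁅ a ⁆ ⁅ b ⁆ (subst (u ∈_) R∩K≡ (x∈p∩q⁺ (u∈R , w∈K))) of λ where
          (inj₁ u∈a) → ≢aa (cong₂ _,_ (x∈⁅y⁆⇒x≡y a u∈a) (x∈⁅y⁆⇒x≡y a u∈a))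
          (inj₂ u∈b) → ≢bb (cong₂ _,_ (x∈⁅y⁆⇒x≡y b u∈b) (x∈⁅y⁆⇒x≡y b u∈b)) })

-- Full products as complete bipartite graphs

completeBipartite : (P : Configuration n) → (∀ u w → (u , w) ∈ᶜ P ⇔ (u ∈ R P × w ∈ K P)) →
  IsCompleteBipartite (∣ R P ∣) (∣ K P ∣) P
completeBipartite {n} P mem
  -- Sizes become list lengths, so that `φ` can send an index to the color at that position.
  rewrite sym (length-elements (R P)) | sym (length-elements (K P)) = φ , φ-injective , onto , edges
  where
  rows cols : List (Fin n)
  rows = elements (R P)
  cols = elements (K P)

  φ : Fin (length rows) ⊎ Fin (length cols) → Vertex n
  φ = Sum.map (lookup rows) (lookup cols)

  φ-injective : Injective _≡_ _≡_ φ
  φ-injective {inj₁ i} {inj₁ j} eq =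
    cong inj₁ (lookup-injective (elements-unique (R P)) (inj₁-injective eq))
  φ-injective {inj₂ i} {inj₂ j} eq =
    cong inj₂ (lookup-injective (elements-unique (K P)) (inj₂-injective eq))

  onto : ∀ w → IsVertex P w ⇔ (∃[ i ] φ i ≡ w)
  onto (inj₁ x) = mk⇔
    (λ x∈R → let x∈ = ∈-elements⁺ x∈R in inj₁ (index x∈) , cong inj₁ (sym (Any.lookup-index x∈)))
    (λ { (inj₁ i , refl) → ∈-elements⁻ (∈-lookup i) })
  onto (inj₂ y) = mk⇔
    (λ y∈K → let y∈ = ∈-elements⁺ y∈K in inj₂ (index y∈) , cong inj₂ (sym (Any.lookup-index y∈)))
    (λ { (inj₂ j , refl) → ∈-elements⁻ (∈-lookup j) })

  row-col : ∀ i j → Edge P (φ (inj₁ i)) (φ (inj₂ j))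
  row-col i j = edge (from (mem _ _) (∈-elements⁻ (∈-lookup i) , ∈-elements⁻ (∈-lookup j)))

  edges : ∀ i j → SymClosure (CompleteEdge (length rows) (length cols)) i j ⇔
                  SymClosure (Edge P) (φ i) (φ j)
  edges (inj₁ i) (inj₁ j) = mk⇔ (λ { (fwd ()) ; (bwd ()) }) (λ { (fwd ()) ; (bwd ()) })
  edges (inj₁ i) (inj₂ j) = mk⇔ (λ _ → fwd (row-col i j)) (λ _ → fwd (edge i j))
  edges (inj₂ i) (inj₁ j) = mk⇔ (λ _ → bwd (row-col j i)) (λ _ → bwd (edge j i))
  edges (inj₂ i) (inj₂ j) = mk⇔ (λ { (fwd ()) ; (bwd ()) }) (λ { (fwd ()) ; (bwd ()) })

-- Examples of both forms

completeExample : Configuration 5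
completeExample = record
  { pairs    = ps
  ; unique   = from-yes (DecUnique.unique? _≟_ ps)
  ; distinct = from-yes (all? (λ (x , y) → ¬? (x Fin.≟ y)) ps)
  }
  where
  _≟_ = ≡-dec Fin._≟_ Fin._≟_
  ps  = cartesianProduct (# 0 ∷ # 1 ∷ []) (# 2 ∷ # 3 ∷ # 4 ∷ [])

-- a = 0, b = 1, x = 2 and y = 3.
deletedExample : Configuration 4
deletedExample = record
  { pairs    = ps
  ; unique   = from-yes (DecUnique.unique? _≟_ ps)
  ; distinct = from-yes (all? (λ (x , y) → ¬? (x Fin.≟ y)) ps)
  }
  where
  _≟_ = ≡-dec Fin._≟_ Fin._≟_
  ps  = (# 0 , # 1) ∷ (# 0 , # 3) ∷ (# 1 , # 0) ∷ (# 1 , # 3) ∷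
        (# 2 , # 0) ∷ (# 2 , # 1) ∷ (# 2 , # 3) ∷ []

-- The two sides of the saturation bound evaluate to 6 here and to 9 for `deletedExample`, so
-- `ℕ.≤-refl` proves it.
completeExample-form : CompleteForm completeExample
completeExample-form = shape⇒completeForm completeExample (saturated completeExample ℕ.≤-refl) refl

deletedExample-form : DeletedForm deletedExample
deletedExample-form = shape⇒deletedForm deletedExample (saturated deletedExample ℕ.≤-refl) refl

-- Characterization of the equality cases

form⇒tight : (P : Configuration n) → CompleteForm P ⊎ DeletedForm P →
  Saturated P × (shape P ≡ (2 , 3 , 0) ⊎ shape P ≡ (3 , 3 , 2))
form⇒tight P (inj₁ form) = completeForm⇒saturated P form , inj₁ (completeForm⇒shape P form)
form⇒tight P (inj₂ form) = deletedForm⇒saturated P form , inj₂ (deletedForm⇒shape P form)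

-- Only saturation and shape are carried back from `Q` to `P`; connectedness and the edge count of
-- `P` are rebuilt from them.
∼-form⇒extremal : (P : Configuration m) (Q : Configuration n) → P ∼ Q →
  CompleteForm Q ⊎ DeletedForm Q → Bicyclic P × e P + s P ≡ 11
∼-form⇒extremal P Q P∼Q form with satQ , shapeQ ← form⇒tight Q form with P∼Q
... | inj₁ (f , relabels) = tight⇒bicyclic P (saturated-relabels⁻ P Q relabels satQ)
  (Sum.map (trans (relabels⇒shape≡ P Q relabels)) (inj₂ ∘ trans (relabels⇒shape≡ P Q relabels)) shapeQ)
... | inj₂ (f , relabels) = tight⇒bicyclic P
  (saturated-interchange⁻ P (saturated-relabels⁻ (interchange P) Q relabels satQ))
  -- Interchanging turns `(2 , 3 , 0)` into `(3 , 2 , 0)` and fixes `(3 , 3 , 2)`.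
  (inj₂ (Sum.map (shape-interchange⁻ P ∘ trans shape≡) (shape-interchange⁻ P ∘ trans shape≡) shapeQ))
  where shape≡ = relabels⇒shape≡ (interchange P) Q relabels

extremal⇒∼-form : (P : Configuration n) → Bicyclic P → e P + s P ≡ 11 →
  ∃₂ λ m (Q : Configuration m) → P ∼ Q × (CompleteForm Q ⊎ DeletedForm Q)
extremal⇒∼-form P bicyclic e+s≡11 with bicyclic⇒tight P bicyclic (ℕ.≤-reflexive e+s≡11)
... | tight with bicyclic⇒saturated P bicyclic tight | tight
...   | sat | inj₁ shape≡ =
  _ , P , inj₁ (id , relabels-refl P) , inj₁ (shape⇒completeForm P sat shape≡)
-- With three rows and two columns, it is `interchange P` that has the complete form.
...   | sat | inj₂ (inj₁ shape≡) =
  _ , interchange P , inj₂ (id , relabels-refl (interchange P)) ,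
  inj₁ (shape⇒completeForm (interchange P) (saturated-interchange⁺ P sat) (shape-interchange P shape≡))
...   | sat | inj₂ (inj₂ shape≡) =
  _ , P , inj₁ (id , relabels-refl P) , inj₂ (shape⇒deletedForm P sat shape≡)

-- The shape `(3 , 3 , 2)` differs from `(2 , 3 , 0)` and from its interchange `(3 , 2 , 0)`.
complete≁deleted : (P : Configuration m) (Q : Configuration n) →
  CompleteForm P → DeletedForm Q → ¬ (P ∼ Q)
complete≁deleted P Q formP formQ (inj₁ (f , relabels)) = case trans (sym (completeForm⇒shape P formP))
  (trans (relabels⇒shape≡ P Q relabels) (deletedForm⇒shape Q formQ)) of λ ()
complete≁deleted P Q formP formQ (inj₂ (f , relabels)) =
  case trans (sym (shape-interchange P (completeForm⇒shape P formP)))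
    (trans (relabels⇒shape≡ (interchange P) Q relabels) (deletedForm⇒shape Q formQ)) of λ ()

lemma4p2 : (∃₂ λ n (P : Configuration n) → Bicyclic P × e P + s P ≡ 11) ×
    (∀ {n} (P : Configuration n) → Bicyclic P → 11 ≤ e P + s P) ×
    (∀ {n} (P : Configuration n) →
    (Bicyclic P × e P + s P ≡ 11) ⇔
    (∃₂ λ m (Q : Configuration m) → P ∼ Q × (CompleteForm Q ⊎ DeletedForm Q))) ×
    (∀ {n} (P : Configuration n) → CompleteForm P → IsCompleteBipartite 2 3 P) ×
    (∃₂ λ n (P : Configuration n) → CompleteForm P) ×
    (∃₂ λ n (P : Configuration n) → DeletedForm P) ×
    (∀ {m n} (P : Configuration m) (Q : Configuration n) →
    CompleteForm P → CompleteForm Q → P ∼ Q) ×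
    (∀ {m n} (P : Configuration m) (Q : Configuration n) →
    DeletedForm P → DeletedForm Q → P ∼ Q) ×
    (∀ {m n} (P : Configuration m) (Q : Configuration n) →
    CompleteForm P → DeletedForm Q → ¬ (P ∼ Q))
lemma4p2 =
  (_ , completeExample ,
    tight⇒bicyclic completeExample (saturated completeExample ℕ.≤-refl) (inj₁ refl)) ,
  bicyclic⇒11≤e+s ,
  (λ P → mk⇔ (λ (bicyclic , e+s≡11) → extremal⇒∼-form P bicyclic e+s≡11)
             (λ (_ , Q , P∼Q , form) → ∼-form⇒extremal P Q P∼Q form)) ,
  (λ { P (r≡ , k≡ , _ , mem) →
    subst₂ (λ r k → IsCompleteBipartite r k P) r≡ k≡ (completeBipartite P mem) }) ,
  (_ , completeExample , completeExample-form) ,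
  (_ , deletedExample , deletedExample-form) ,
  (λ P Q formP formQ → saturated∧shape≡⇒∼ P Q
    (completeForm⇒saturated P formP) (completeForm⇒saturated Q formQ)
    (subst (0 <_) (sym (cong proj₁ (completeForm⇒shape Q formQ))) (s≤s z≤n))
    (trans (completeForm⇒shape P formP) (sym (completeForm⇒shape Q formQ)))) ,
  (λ P Q formP formQ → saturated∧shape≡⇒∼ P Q
    (deletedForm⇒saturated P formP) (deletedForm⇒saturated Q formQ)
    (subst (0 <_) (sym (cong proj₁ (deletedForm⇒shape Q formQ))) (s≤s z≤n))
    (trans (deletedForm⇒shape P formP) (sym (deletedForm⇒shape Q formQ)))) ,
  complete≁deleted
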